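{- Let $M\subseteq N$ and $r\in\mathbb{R}^{\mathcal{P}(M)}$. (i) Then $r\in\mathcal{K}(M)$ if and only if $T_{M\nearrow N}(r)\in\mathcal{K}(N)$, and the independency model induced by $T_{M\nearrow N}(r)$ is determined as follows: for any $\langle a,b|C\rangle\in\mathcal{E}(N)$, $$a\perp b\mid C\ [T_{M\nearrow N}(r)]\iff \bigl\{\,a\notin M\ \text{ or }\ b\notin M\ \text{ or }\ a\perp b\mid C\cap M\ [r]\,\bigr\}.$$ In particular, $T_{M\nearrow N}$ maps $\mathcal{K}(M)$ into $\mathcal{K}(N)$. (ii) The lifting transformation commutes with the basic standardizations: for $r\in\mathcal{K}(M)$, $$(T_{M\nearrow N}(r))_\ell=T_{M\nearrow N}(r_\ell),\quad (T_{M\nearrow N}(r))_u=T_{M\nearrow N}(r_u),\quad (T_{M\nearrow N}(r))_o=T_{M\nearrow N}(r_o).$$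
   Context: $N$ is a finite set with $|N|\ge 2$ and $\mathcal{P}(N)$ is its power set; a singleton $\{a\}$ is written $a$. $\mathbb{R}^{\mathcal{P}(N)}$ is the space of functions $m:\mathcal{P}(N)\to\mathbb{R}$. A function $m$ is supermodular if $m(A)+m(B)\le m(A\cup B)+m(A\cap B)$ for all $A,B\subseteq N$, and modular if equality always holds; $\mathcal{K}(N)$ and $\mathcal{L}(N)$ denote the classes of supermodular and modular functions. The same definitions are used for other finite sets in place of $N$. $\mathcal{E}(N)$ is the set of triplets $\langle a,b|C\rangle$ with $a,b\in N$ distinct and $C\subseteq N\setminus\{a,b\}$. For $m\in\mathbb{R}^{\mathcal{P}(N)}$, $a\perp b\mid C\ [m]$ means $m(a\cup b\cup C)+m(C)-m(a\cup C)-m(b\cup C)=0$. The independency model induced by $m\in\mathcal{K}(N)$ is the set of $\langle a,b|C\rangle\in\mathcal{E}(N)$ with $a\perp b\mid C\ [m]$. The lifting transformation $T_{M\nearrow N}:\mathbb{R}^{\mathcal{P}(M)}\to\mathbb{R}^{\mathcal{P}(N)}$ is $[T_{M\nearrow N}(r)](S)=r(S\cap M)$ for $S\subseteq N$. Standardizations: each of the following linear subspaces is complementary to $\mathcal{L}(N)$ in $\mathbb{R}^{\mathcal{P}(N)}$: $\mathcal{S}_\ell(N)=\{m: m(\emptyset)=0,\ m(i)=0\ \forall i\in N\}$; $\mathcal{S}_u(N)=\{m: m(N)=0,\ m(N\setminus i)=0\ \forall i\in N\}$; $\mathcal{S}_o(N)=\{m:\sum_{S\subseteq N}m(S)=0,\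 \sum_{S\subseteq N,\,i\in S}m(S)=0\ \forall i\in N\}$. For $m\in\mathbb{R}^{\mathcal{P}(N)}$, $m_\ell$, $m_u$, $m_o$ denote the unique elements of $\mathcal{S}_\ell(N)$, $\mathcal{S}_u(N)$, $\mathcal{S}_o(N)$, respectively, differing from $m$ by an element of $\mathcal{L}(N)$. -}

module Defs where

open import Data.Bool.Base using (if_then_else_)
open import Data.Empty using (⊥-elim-irr) renaming (⊥ to 𝟘)
open import Data.Fin.Base using (Fin; zero; suc)
open import Data.Fin.Subset
  using (Subset; inside; outside; ⊥; ⁅_⁆; _∈_; _∉_; _⊆_; _∪_; _∩_; _─_)
open import Data.Fin.Subset.Properties
open import Data.Nat.Base as ℕ using (ℕ; _⊔_)
import Data.Nat.Properties as ℕ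
open import Data.Product using (∃; ∃!; _×_; _,_; proj₁; proj₂)
open import Data.Rational.Base as ℚ using (ℚ; 0ℚ; ½; ∣_∣)
import Data.Rational.Properties as ℚ
open import Data.Rational.Solver using (module +-*-Solver)
open import Data.Sum.Base using (_⊎_; inj₁; inj₂)
open import Data.Vec.Base using ([]; _∷_; here; there)
open import Function.Base using (_∘_)
open import Relation.Binary.PropositionalEquality
  using (_≡_; _≢_; refl; sym; trans; cong; cong₂; subst)
open import Relation.Nullary using (does)

open +-*-Solver using (solve; _:+_; _:-_; :-_; _:=_; con)

------------------------------------------------------------------------
-- Real numbers: rational Cauchy sequences up to vanishing difference.
-- Multiplication is omitted: only the ordered additive structure occurs.

IsCauchy : (ℕ → ℚ) → Set
IsCauchy f = ∀ ε → 0ℚ ℚ.< ε →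
  ∃ λ K → ∀ m n → K ℕ.≤ m → K ℕ.≤ n → ∣ f m ℚ.- f n ∣ ℚ.≤ ε

record ℝ : Set where
  constructor mkℝ
  field
    seq    : ℕ → ℚ
    cauchy : IsCauchy seq

open ℝ public

infix  4 _≈_ _≤_
infixl 6 _+_ _-_
infix  8 -_

record _≈_ (x y : ℝ) : Set where
  constructor mk≈
  field
    null : ∀ ε → 0ℚ ℚ.< ε →
           ∃ λ K → ∀ n → K ℕ.≤ n → ∣ seq x n ℚ.- seq y n ∣ ℚ.≤ ε

record _≤_ (x y : ℝ) : Set where
  constructor mk≤
  field
    below : ∀ ε → 0ℚ ℚ.< ε →
            ∃ λ K → ∀ n → K ℕ.≤ n → seq x n ℚ.≤ seq y n ℚ.+ ε

open _≈_ public
open _≤_ public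

½-pos : ∀ {ε} → 0ℚ ℚ.< ε → 0ℚ ℚ.< ½ ℚ.* ε
½-pos {ε} 0<ε = subst (ℚ._< ½ ℚ.* ε) (ℚ.*-zeroʳ ½) (ℚ.*-monoʳ-<-pos ½ 0<ε)

½+½ : ∀ ε → ½ ℚ.* ε ℚ.+ ½ ℚ.* ε ≡ ε
½+½ ε = trans (sym (ℚ.*-distribʳ-+ ε ½ ½)) (ℚ.*-identityˡ ε)

½*-double : ∀ p → ½ ℚ.* (p ℚ.+ p) ≡ p
½*-double p = trans (ℚ.*-distribˡ-+ ½ p p) (½+½ p)

½*-sub : ∀ p q → ½ ℚ.* (p ℚ.- q) ≡ ½ ℚ.* p ℚ.- ½ ℚ.* q
½*-sub p q = trans (ℚ.*-distribˡ-+ ½ p (ℚ.- q))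
  (cong (½ ℚ.* p ℚ.+_) (sym (ℚ.neg-distribʳ-* ½ q)))

∣+∣≤ : ∀ {p q ε} → ∣ p ∣ ℚ.≤ ½ ℚ.* ε → ∣ q ∣ ℚ.≤ ½ ℚ.* ε → ∣ p ℚ.+ q ∣ ℚ.≤ ε
∣+∣≤ {p} {q} {ε} hp hq = ℚ.≤-trans (ℚ.∣p+q∣≤∣p∣+∣q∣ p q)
  (ℚ.≤-trans (ℚ.+-mono-≤ hp hq) (ℚ.≤-reflexive (½+½ ε)))

∣½*∣≤ : ∀ p → ∣ ½ ℚ.* p ∣ ℚ.≤ ∣ p ∣
∣½*∣≤ p = ℚ.≤-trans (ℚ.≤-reflexive (ℚ.∣p*q∣≡∣p∣*∣q∣ ½ p))
  (ℚ.≤-trans (ℚ.≤-reflexive (sym (ℚ.+-identityʳ _)))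
  (ℚ.≤-trans (ℚ.+-monoʳ-≤ (½ ℚ.* ∣ p ∣) 0≤) (ℚ.≤-reflexive (½+½ ∣ p ∣))))
  where
  0≤ : 0ℚ ℚ.≤ ½ ℚ.* ∣ p ∣
  0≤ = subst (ℚ._≤ ½ ℚ.* ∣ p ∣) (ℚ.*-zeroʳ ½) (ℚ.*-monoˡ-≤-nonNeg ½ (ℚ.0≤∣p∣ p))

0ℝ : ℝ
0ℝ = mkℝ (λ _ → 0ℚ) (λ ε 0<ε → 0 , λ _ _ _ _ → ℚ.<⇒≤ 0<ε)

-- Abstract, to keep these proofs out of conversion checking.
abstract
  +-cauchy : ∀ x y → IsCauchy (λ n → seq x n ℚ.+ seq y n)
  +-cauchy x y ε 0<ε =
    let K , f = cauchy x (½ ℚ.* ε) (½-pos 0<ε)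
        L , g = cauchy y (½ ℚ.* ε) (½-pos 0<ε)
    in K ⊔ L , λ m n hm hn →
       subst (λ z → ∣ z ∣ ℚ.≤ ε)
         (solve 4 (λ a b c d → (a :- b) :+ (c :- d) := (a :+ c) :- (b :+ d)) refl
           (seq x m) (seq x n) (seq y m) (seq y n))
         (∣+∣≤ (f m n (ℕ.m⊔n≤o⇒m≤o K L hm) (ℕ.m⊔n≤o⇒m≤o K L hn))
               (g m n (ℕ.m⊔n≤o⇒n≤o K L hm) (ℕ.m⊔n≤o⇒n≤o K L hn)))

  neg-cauchy : ∀ x → IsCauchy (λ n → ℚ.- seq x n)
  neg-cauchy x ε 0<ε =
    let K , f = cauchy x ε 0<ε in K , λ m n hm hn →
    subst (ℚ._≤ ε)
      (trans (sym (ℚ.∣-p∣≡∣p∣ (seq x m ℚ.- seq x n)))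
        (cong ∣_∣ (solve 2 (λ a b → :- (a :- b) := (:- a) :- (:- b)) refl
          (seq x m) (seq x n))))
      (f m n hm hn)

  half-cauchy : ∀ x → IsCauchy (λ n → ½ ℚ.* seq x n)
  half-cauchy x ε 0<ε =
    let K , f = cauchy x ε 0<ε in K , λ m n hm hn →
    subst (λ z → ∣ z ∣ ℚ.≤ ε) (½*-sub (seq x m) (seq x n))
      (ℚ.≤-trans (∣½*∣≤ (seq x m ℚ.- seq x n)) (f m n hm hn))

_+_ : ℝ → ℝ → ℝ
x + y = mkℝ (λ n → seq x n ℚ.+ seq y n) (+-cauchy x y)

-_ : ℝ → ℝ
- x = mkℝ (λ n → ℚ.- seq x n) (neg-cauchy x)

_-_ : ℝ → ℝ → ℝ
x - y = x + (- y)

half : ℝ → ℝ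
half x = mkℝ (λ n → ½ ℚ.* seq x n) (half-cauchy x)

-- Equality depends only on the difference sequence, so equations follow from
-- a hypothesis by rational identities checked termwise.
≈-by : ∀ {a b x y} → a ≈ b →
       (∀ n → seq a n ℚ.- seq b n ≡ seq x n ℚ.- seq y n) → x ≈ y
≈-by a≈b eq = mk≈ λ ε 0<ε →
  let K , f = null a≈b ε 0<ε in
  K , λ n hn → subst (λ z → ∣ z ∣ ℚ.≤ ε) (eq n) (f n hn)

≈-refl : ∀ {x} → x ≈ x
≈-refl {x} = mk≈ λ ε 0<ε → 0 , λ n _ →
  subst (λ z → ∣ z ∣ ℚ.≤ ε) (sym (ℚ.+-inverseʳ (seq x n))) (ℚ.<⇒≤ 0<ε)

≈-reflexive : ∀ {x y} → x ≡ y → x ≈ y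
≈-reflexive refl = ≈-refl

≈-termwise : ∀ {x y} → (∀ n → seq x n ≡ seq y n) → x ≈ y
≈-termwise {x} {y} eq =
  ≈-by (≈-refl {x}) (λ n → cong (λ z → seq x n ℚ.- z) (eq n))

+-cong : ∀ {x x′ y y′} → x ≈ x′ → y ≈ y′ → x + y ≈ x′ + y′
+-cong {x} {x′} {y} {y′} p q = mk≈ λ ε 0<ε →
  let K , f = null p (½ ℚ.* ε) (½-pos 0<ε)
      L , g = null q (½ ℚ.* ε) (½-pos 0<ε)
  in K ⊔ L , λ n hn →
     subst (λ z → ∣ z ∣ ℚ.≤ ε)
       (solve 4 (λ a b c d → (a :- b) :+ (c :- d) := (a :+ c) :- (b :+ d)) refl
         (seq x n) (seq x′ n) (seq y n) (seq y′ n))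
       (∣+∣≤ (f n (ℕ.m⊔n≤o⇒m≤o K L hn)) (g n (ℕ.m⊔n≤o⇒n≤o K L hn)))

≈-sym : ∀ {x y} → x ≈ y → y ≈ x
≈-sym {x} {y} p = mk≈ λ ε 0<ε →
  let K , f = null p ε 0<ε in K , λ n hn →
  subst (ℚ._≤ ε)
    (trans (sym (ℚ.∣-p∣≡∣p∣ (seq x n ℚ.- seq y n)))
      (cong ∣_∣ (solve 2 (λ a b → :- (a :- b) := b :- a) refl
        (seq x n) (seq y n))))
    (f n hn)

≈-trans : ∀ {x y z} → x ≈ y → y ≈ z → x ≈ z
≈-trans {x} {y} {z} p q = ≈-by (+-cong p q) λ n →
  solve 3 (λ a b c → (a :+ b) :- (b :+ c) := a :- c) refl
    (seq x n) (seq y n) (seq z n)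

neg-cong : ∀ {x y} → x ≈ y → - x ≈ - y
neg-cong {x} {y} p = ≈-by (≈-sym p) λ n →
  solve 2 (λ a b → b :- a := (:- a) :- (:- b)) refl (seq x n) (seq y n)

sub-cong : ∀ {x x′ y y′} → x ≈ x′ → y ≈ y′ → x - y ≈ x′ - y′
sub-cong p q = +-cong p (neg-cong q)

half-cong : ∀ {x y} → x ≈ y → half x ≈ half y
half-cong {x} {y} p = mk≈ λ ε 0<ε →
  let K , f = null p ε 0<ε in K , λ n hn →
  subst (λ z → ∣ z ∣ ℚ.≤ ε)
    (½*-sub (seq x n) (seq y n))
    (ℚ.≤-trans (∣½*∣≤ (seq x n ℚ.- seq y n)) (f n hn))

half+half : ∀ x → half x + half x ≈ x
half+half x = ≈-termwise λ n → ½+½ (seq x n)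

double-cancel : ∀ {x y} → x + x ≈ y + y → x ≈ y
double-cancel {x} {y} p = ≈-by (half-cong p) λ n →
  cong₂ ℚ._-_ (½*-double (seq x n)) (½*-double (seq y n))

diff≈0 : ∀ {x y} → x - y ≈ 0ℝ → x ≈ y
diff≈0 {x} {y} p = ≈-by p λ n →
  solve 2 (λ a b → (a :- b) :- con 0ℚ := a :- b) refl (seq x n) (seq y n)

≈0⇐ : ∀ {x y} → x ≈ y → x - y ≈ 0ℝ
≈0⇐ {x} {y} p = ≈-by p λ n →
  solve 2 (λ a b → a :- b := (a :- b) :- con 0ℚ) refl (seq x n) (seq y n)

------------------------------------------------------------------------
-- Power sets. Finite sets are subsets X of an ambient Fin u. The inclusion
-- proof is irrelevant, so a function on 𝒫 X depends on the subset alone.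

record 𝒫 {u} (X : Subset u) : Set where
  constructor mk𝒫
  field
    set  : Subset u
    .sub : set ⊆ X

open 𝒫 public using (set)

𝒫-≡ : ∀ {u} {X : Subset u} {A B : 𝒫 X} → set A ≡ set B → A ≡ B
𝒫-≡ {A = mk𝒫 _ _} {mk𝒫 _ _} refl = refl

∪-⊆ : ∀ {u} {X : Subset u} A B → A ⊆ X → B ⊆ X → A ∪ B ⊆ X
∪-⊆ A B p q x∈ with x∈p∪q⁻ A B x∈
... | inj₁ x∈A = p x∈A
... | inj₂ x∈B = q x∈B

module _ {u} {X : Subset u} where

  infixr 7 _∩ₚ_
  infixr 6 _∪ₚ_

  ∅ₚ : 𝒫 X
  ∅ₚ = mk𝒫 ⊥ (λ {x} → ⊆-min X {x})

  fullₚ : 𝒫 X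
  fullₚ = mk𝒫 X (λ p → p)

  _∪ₚ_ : 𝒫 X → 𝒫 X → 𝒫 X
  mk𝒫 A p ∪ₚ mk𝒫 B q = mk𝒫 (A ∪ B) (λ {x} → ∪-⊆ A B p q {x})

  _∩ₚ_ : 𝒫 X → 𝒫 X → 𝒫 X
  mk𝒫 A p ∩ₚ mk𝒫 B q = mk𝒫 (A ∩ B) (λ x∈ → p (p∩q⊆p A B x∈))

  ⁅_⁆ₚ : ∀ {i} → i ∈ X → 𝒫 X
  ⁅_⁆ₚ {i} i∈X = mk𝒫 ⁅ i ⁆ λ x∈ → subst (_∈ X) (sym (x∈⁅y⁆⇒x≡y i x∈)) i∈X

  removeₚ : Fin u → 𝒫 X
  removeₚ i = mk𝒫 (X ─ ⁅ i ⁆) (λ {x} → p─q⊆p X ⁅ i ⁆ {x})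

-- S ∩ M, viewed as a subset of M.
restrict : ∀ {u} {N : Subset u} (M : Subset u) → 𝒫 N → 𝒫 M
restrict M (mk𝒫 S _) = mk𝒫 (S ∩ M) (λ {x} → p∩q⊆q S M {x})

outₚ : ∀ {u s} {X : Subset u} → 𝒫 X → 𝒫 (s ∷ X)
outₚ (mk𝒫 A p) = mk𝒫 (outside ∷ A) (λ {x} → out⊆ p {x})

inₚ : ∀ {u} {X : Subset u} → 𝒫 X → 𝒫 (inside ∷ X)
inₚ (mk𝒫 A p) = mk𝒫 (inside ∷ A) (λ {x} → in⊆in p {x})

------------------------------------------------------------------------
-- Set functions

SetFn : ∀ {u} → Subset u → Set
SetFn X = 𝒫 X → ℝ

infix 4 _≐_
_≐_ : ∀ {u} {X : Subset u} → SetFn X → SetFn X → Set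
m ≐ m′ = ∀ S → m S ≈ m′ S

infixl 6 _⊖_
_⊖_ : ∀ {u} {X : Subset u} → SetFn X → SetFn X → SetFn X
(m ⊖ m′) S = m S - m′ S

-- The sum of m S over all S ⊆ X, each subset occurring exactly once.
∑ : ∀ {u} (X : Subset u) → SetFn X → ℝ
∑ []            m = m ∅ₚ
∑ (outside ∷ X) m = ∑ X (m ∘ outₚ)
∑ (inside ∷ X)  m = ∑ X (m ∘ outₚ) + ∑ X (m ∘ inₚ)

-- The sum of m S over all S ⊆ X with i ∈ S.
∑∋ : ∀ {u} (X : Subset u) → Fin u → SetFn X → ℝ
∑∋ X i m = ∑ X (λ S → if does (i ∈? set S) then m S else 0ℝ)

module _ {u} {X : Subset u} where

  Supermodular : SetFn X → Set
  Supermodular m = ∀ A B → m A + m B ≤ m (A ∪ₚ B) + m (A ∩ₚ B)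

  Modular : SetFn X → Set
  Modular m = ∀ A B → m A + m B ≈ m (A ∪ₚ B) + m (A ∩ₚ B)

  𝒮ℓ : SetFn X → Set
  𝒮ℓ m = m ∅ₚ ≈ 0ℝ × (∀ {i} (i∈X : i ∈ X) → m ⁅ i∈X ⁆ₚ ≈ 0ℝ)

  𝒮u : SetFn X → Set
  𝒮u m = m fullₚ ≈ 0ℝ × (∀ {i} → i ∈ X → m (removeₚ i) ≈ 0ℝ)

  𝒮o : SetFn X → Set
  𝒮o m = ∑ X m ≈ 0ℝ × (∀ {i} → i ∈ X → ∑∋ X i m ≈ 0ℝ)

  IsStandardization : (SetFn X → Set) → SetFn X → SetFn X → Set
  IsStandardization 𝒮 m s = 𝒮 s × Modular (m ⊖ s)

  -- ⟨a,b|C⟩ ∈ ℰ(X), where a, b ∈ X and C ⊆ X are given by typing.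
  IsTriplet : (a b : ∃ (_∈ X)) → 𝒫 X → Set
  IsTriplet (a , _) (b , _) C = a ≢ b × a ∉ set C × b ∉ set C

  infix 4 _⊥_∣_[_]
  _⊥_∣_[_] : (a b : ∃ (_∈ X)) → 𝒫 X → SetFn X → Set
  (_ , a) ⊥ (_ , b) ∣ C [ m ] =
    m (⁅ a ⁆ₚ ∪ₚ ⁅ b ⁆ₚ ∪ₚ C) + m C - m (⁅ a ⁆ₚ ∪ₚ C) - m (⁅ b ⁆ₚ ∪ₚ C) ≈ 0ℝ

-- T_{M↗N}
lift : ∀ {u} {M : Subset u} (N : Subset u) → SetFn M → SetFn N
lift {M = M} N r S = r (restrict M S)

------------------------------------------------------------------------
-- Modular functions S ↦ c + Σ_{i∈S} x i

sumE : ∀ {u} → Subset u → (Fin u → ℝ) → ℝ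
sumE []            x = 0ℝ
sumE (outside ∷ A) x = sumE A (x ∘ suc)
sumE (inside ∷ A)  x = x zero + sumE A (x ∘ suc)

sumE-⊥ : ∀ {u} (x : Fin u → ℝ) → sumE ⊥ x ≈ 0ℝ
sumE-⊥ {ℕ.zero}  x = ≈-refl
sumE-⊥ {ℕ.suc u} x = sumE-⊥ (x ∘ suc)

x+0 : ∀ {x z} → z ≈ 0ℝ → x + z ≈ x
x+0 {x} {z} p = ≈-by p λ n →
  solve 2 (λ a b → b :- con 0ℚ := (a :+ b) :- a) refl (seq x n) (seq z n)

sumE-⁅⁆ : ∀ {u} i (x : Fin u → ℝ) → sumE ⁅ i ⁆ x ≈ x i
sumE-⁅⁆ zero    x = x+0 (sumE-⊥ (x ∘ suc))
sumE-⁅⁆ (suc i) x = sumE-⁅⁆ i (x ∘ suc)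

sumE-remove : ∀ {u} {X : Subset u} {i} → i ∈ X → (x : Fin u → ℝ) →
              sumE X x ≈ sumE (X ─ ⁅ i ⁆) x + x i
sumE-remove {X = inside ∷ X} here x = ≈-trans
  (≈-termwise λ n → ℚ.+-comm (seq (x zero) n) (seq (sumE X (x ∘ suc)) n))
  (≈-reflexive (cong (λ Y → sumE Y (x ∘ suc) + x zero) (sym (p─⊥≡p X))))
sumE-remove {X = outside ∷ X} (there p) x = sumE-remove p (x ∘ suc)
sumE-remove {X = inside ∷ X} {suc i} (there p) x =
  ≈-by (sumE-remove p (x ∘ suc)) λ n →
  solve 4 (λ a b c d → a :- (b :+ c) := (d :+ a) :- ((d :+ b) :+ c)) refl
    (seq (sumE X (x ∘ suc)) n) (seq (sumE (X ─ ⁅ i ⁆) (x ∘ suc)) n)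
    (seq (x (suc i)) n) (seq (x zero) n)

sumE-modular : ∀ {u} (A B : Subset u) (x : Fin u → ℝ) →
               sumE A x + sumE B x ≈ sumE (A ∪ B) x + sumE (A ∩ B) x
sumE-modular [] [] x = ≈-refl
sumE-modular (s ∷ A) (t ∷ B) x with sumE-modular A B (x ∘ suc)
... | ih = go s t
  where
  a = sumE A (x ∘ suc)
  b = sumE B (x ∘ suc)
  c = sumE (A ∪ B) (x ∘ suc)
  d = sumE (A ∩ B) (x ∘ suc)
  go : ∀ s t → sumE (s ∷ A) x + sumE (t ∷ B) x
             ≈ sumE ((s ∷ A) ∪ (t ∷ B)) x + sumE ((s ∷ A) ∩ (t ∷ B)) x
  go outside outside = ih
  go outside inside  = ≈-by ih λ n →
    solve 5 (λ a b c d z → (a :+ b) :- (c :+ d)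
                        := (a :+ (z :+ b)) :- ((z :+ c) :+ d)) refl
      (seq a n) (seq b n) (seq c n) (seq d n) (seq (x zero) n)
  go inside outside  = ≈-by ih λ n →
    solve 5 (λ a b c d z → (a :+ b) :- (c :+ d)
                        := ((z :+ a) :+ b) :- ((z :+ c) :+ d)) refl
      (seq a n) (seq b n) (seq c n) (seq d n) (seq (x zero) n)
  go inside inside   = ≈-by ih λ n →
    solve 5 (λ a b c d z → (a :+ b) :- (c :+ d)
                        := ((z :+ a) :+ (z :+ b)) :- ((z :+ c) :+ (z :+ d)))
      refl
      (seq a n) (seq b n) (seq c n) (seq d n) (seq (x zero) n)

affine : ∀ {u} {X : Subset u} → ℝ → (Fin u → ℝ) → SetFn X
affine c x S = c + sumE (set S) x

affine-modular : ∀ {u} {X : Subset u} c x → Modular {X = X} (affine c x)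
affine-modular c x (mk𝒫 A _) (mk𝒫 B _) = ≈-by (sumE-modular A B x) λ n →
  solve 5 (λ a b d e c → (a :+ b) :- (d :+ e)
                      := ((c :+ a) :+ (c :+ b)) :- ((c :+ d) :+ (c :+ e))) refl
    (seq (sumE A x) n) (seq (sumE B x) n) (seq (sumE (A ∪ B) x) n)
    (seq (sumE (A ∩ B) x) n) (seq c n)

modular-cong : ∀ {u} {X : Subset u} {m m′ : SetFn X} →
               m ≐ m′ → Modular m → Modular m′
modular-cong e mod A B =
  ≈-trans (+-cong (≈-sym (e A)) (≈-sym (e B)))
    (≈-trans (mod A B) (+-cong (e (A ∪ₚ B)) (e (A ∩ₚ B))))

modular-⊖ : ∀ {u} {X : Subset u} {m m′ : SetFn X} →
            Modular m → Modular m′ → Modular (m ⊖ m′)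
modular-⊖ {m = m} {m′} p q A B = ≈-by (sub-cong (p A B) (q A B)) λ n →
  solve 8 (λ a b c d a′ b′ c′ d′ →
      ((a :+ b) :- (a′ :+ b′)) :- ((c :+ d) :- (c′ :+ d′))
   := ((a :- a′) :+ (b :- b′)) :- ((c :- c′) :+ (d :- d′))) refl
    (seq (m A) n) (seq (m B) n) (seq (m (A ∪ₚ B)) n) (seq (m (A ∩ₚ B)) n)
    (seq (m′ A) n) (seq (m′ B) n) (seq (m′ (A ∪ₚ B)) n) (seq (m′ (A ∩ₚ B)) n)

-- Adding the least element 0 to a set not containing it.
modular-step : ∀ {u} {X : Subset u} {d : SetFn (inside ∷ X)} → Modular d →
               ∀ A → d (inₚ A) - d (outₚ A) ≈ d ⁅ here ⁆ₚ - d ∅ₚ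
modular-step {X = X} {d} mod A = ≈-by step λ n →
  solve 4 (λ i o s e → (i :+ e) :- (s :+ o) := (i :- o) :- (s :- e)) refl
    (seq (d (inₚ A)) n) (seq (d (outₚ A)) n) (seq (d ⁅ here ⁆ₚ) n) (seq (d ∅ₚ) n)
  where
  step : d (inₚ A) + d ∅ₚ ≈ d ⁅ here ⁆ₚ + d (outₚ A)
  step = ≈-sym (≈-trans (mod ⁅ here ⁆ₚ (outₚ A))
    (≈-reflexive (cong₂ (λ S T → d S + d T)
      (𝒫-≡ (cong (inside ∷_) (∪-identityˡ (set A))))
      (𝒫-≡ (cong (outside ∷_) (∩-zeroˡ (set A)))))))

modular-out : ∀ {u s} {X : Subset u} {d : SetFn (s ∷ X)} →
              Modular d → Modular (d ∘ outₚ)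
modular-out mod A B = mod (outₚ A) (outₚ B)

modular-const : ∀ {u} {X : Subset u} {d : SetFn X} → Modular d →
                (∀ {i} (i∈X : i ∈ X) → d ⁅ i∈X ⁆ₚ ≈ d ∅ₚ) → ∀ S → d S ≈ d ∅ₚ
modular-const {X = []} mod h (mk𝒫 [] _) = ≈-refl
modular-const {X = s ∷ X} {d} mod h (mk𝒫 (outside ∷ A) p) =
  modular-const (modular-out {d = d} mod) (λ i∈X → h (there i∈X))
    (mk𝒫 A (drop-∷-⊆ p))
modular-const {X = outside ∷ X} mod h (mk𝒫 (inside ∷ A) p) =
  ⊥-elim-irr (absurd (p here))
  where
  absurd : zero ∈ outside ∷ X → 𝟘
  absurd ()
modular-const {X = inside ∷ X} {d} mod h (mk𝒫 (inside ∷ A) p) =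
  ≈-trans
    (≈-by (≈-trans (modular-step {d = d} mod A′) (≈0⇐ (h here))) λ n →
      solve 2 (λ a b → (a :- b) :- con 0ℚ := a :- b) refl
        (seq (d (inₚ A′)) n) (seq (d (outₚ A′)) n))
    (modular-const (modular-out {d = d} mod) (λ i∈X → h (there i∈X)) A′)
  where
  A′ : 𝒫 X
  A′ = mk𝒫 A (drop-∷-⊆ p)

------------------------------------------------------------------------
-- Properties of sums over power sets

∑-cong : ∀ {u} {X : Subset u} {m m′ : SetFn X} → m ≐ m′ → ∑ X m ≈ ∑ X m′
∑-cong {X = []}          e = e _
∑-cong {X = outside ∷ X} e = ∑-cong (e ∘ outₚ)
∑-cong {X = inside ∷ X}  e = +-cong (∑-cong (e ∘ outₚ)) (∑-cong (e ∘ inₚ))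

∑-+ : ∀ {u} (X : Subset u) (m m′ : SetFn X) →
      ∑ X (λ S → m S + m′ S) ≈ ∑ X m + ∑ X m′
∑-+ []            m m′ = ≈-refl
∑-+ (outside ∷ X) m m′ = ∑-+ X (m ∘ outₚ) (m′ ∘ outₚ)
∑-+ (inside ∷ X)  m m′ =
  ≈-trans (+-cong (∑-+ X (m ∘ outₚ) (m′ ∘ outₚ)) (∑-+ X (m ∘ inₚ) (m′ ∘ inₚ)))
    (≈-termwise λ n →
      solve 4 (λ a b c d → (a :+ b) :+ (c :+ d) := (a :+ c) :+ (b :+ d)) refl
        (seq (∑ X (m ∘ outₚ)) n) (seq (∑ X (m′ ∘ outₚ)) n)
        (seq (∑ X (m ∘ inₚ)) n) (seq (∑ X (m′ ∘ inₚ)) n))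

∑-neg : ∀ {u} (X : Subset u) (m : SetFn X) → ∑ X (λ S → - m S) ≈ - ∑ X m
∑-neg []            m = ≈-refl
∑-neg (outside ∷ X) m = ∑-neg X (m ∘ outₚ)
∑-neg (inside ∷ X)  m =
  ≈-trans (+-cong (∑-neg X (m ∘ outₚ)) (∑-neg X (m ∘ inₚ)))
    (≈-termwise λ n →
      solve 2 (λ a b → (:- a) :+ (:- b) := :- (a :+ b)) refl
        (seq (∑ X (m ∘ outₚ)) n) (seq (∑ X (m ∘ inₚ)) n))

∑-sub : ∀ {u} (X : Subset u) (m m′ : SetFn X) →
      ∑ X (m ⊖ m′) ≈ ∑ X m - ∑ X m′
∑-sub X m m′ = ≈-trans (∑-+ X m (λ S → - m′ S)) (+-cong ≈-refl (∑-neg X m′))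

∑-0 : ∀ {u} (X : Subset u) → ∑ X (λ _ → 0ℝ) ≈ 0ℝ
∑-0 []            = ≈-refl
∑-0 (outside ∷ X) = ∑-0 X
∑-0 (inside ∷ X)  = ≈-trans (+-cong (∑-0 X) (∑-0 X)) (x+0 ≈-refl)

∑∋-cong : ∀ {u} {X : Subset u} i {m m′ : SetFn X} → m ≐ m′ →
          ∑∋ X i m ≈ ∑∋ X i m′
∑∋-cong {X = X} i {m} {m′} e = ∑-cong λ S → go S (does (i ∈? set S))
  where
  go : ∀ S b → (if b then m S else 0ℝ) ≈ (if b then m′ S else 0ℝ)
  go S inside  = e S
  go S outside = ≈-refl

∑∋-+ : ∀ {u} (X : Subset u) i (m m′ : SetFn X) →
       ∑∋ X i (λ S → m S + m′ S) ≈ ∑∋ X i m + ∑∋ X i m′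
∑∋-+ X i m m′ = ≈-trans (∑-cong λ S → go S (does (i ∈? set S))) (∑-+ X _ _)
  where
  go : ∀ S b → (if b then m S + m′ S else 0ℝ)
             ≈ (if b then m S else 0ℝ) + (if b then m′ S else 0ℝ)
  go S inside  = ≈-refl
  go S outside = ≈-sym (x+0 ≈-refl)

∑∋-sub : ∀ {u} (X : Subset u) i (m m′ : SetFn X) →
       ∑∋ X i (m ⊖ m′) ≈ ∑∋ X i m - ∑∋ X i m′
∑∋-sub X i m m′ = ≈-trans (∑-cong λ S → go S (does (i ∈? set S))) (∑-sub X _ _)
  where
  go : ∀ S b → (if b then m S - m′ S else 0ℝ)
             ≈ (if b then m S else 0ℝ) - (if b then m′ S else 0ℝ)
  go S inside  = ≈-refl
  go S outside = ≈-sym (≈0⇐ ≈-refl)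

∑∋-here-out : ∀ {u} (X : Subset u) (m : SetFn (inside ∷ X)) →
              ∑∋ (inside ∷ X) zero m ≈ ∑ X (m ∘ inₚ)
∑∋-here-out X m =
  ≈-trans (+-cong (∑-0 X) ≈-refl) (≈-termwise λ n → ℚ.+-identityˡ _)

-- Division by 2^|X|, the number of subsets of X.
mean : ∀ {u} → Subset u → ℝ → ℝ
mean []            c = c
mean (outside ∷ X) c = mean X c
mean (inside ∷ X)  c = mean X (half c)

∑-mean : ∀ {u} (X : Subset u) c → ∑ X (λ _ → mean X c) ≈ c
∑-mean []            c = ≈-refl
∑-mean (outside ∷ X) c = ∑-mean X c
∑-mean (inside ∷ X)  c =
  ≈-trans (+-cong (∑-mean X (half c)) (∑-mean X (half c))) (half+half c)

∑-const-cancel : ∀ {u} (X : Subset u) {c} → ∑ X (λ _ → c) ≈ 0ℝ → c ≈ 0ℝ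
∑-const-cancel []            p = p
∑-const-cancel (outside ∷ X) p = ∑-const-cancel X p
∑-const-cancel (inside ∷ X)  p =
  ∑-const-cancel X (double-cancel (≈-trans p (≈-sym (x+0 ≈-refl))))

∑∋-const : ∀ {u} {X : Subset u} {i} → i ∈ X → ∀ c →
           ∑∋ X i (λ _ → c) + ∑∋ X i (λ _ → c) ≈ ∑ X (λ _ → c)
∑∋-const {X = inside ∷ X} here c = +-cong p p
  where
  p : ∑∋ (inside ∷ X) zero (λ _ → c) ≈ ∑ X (λ _ → c)
  p = ∑∋-here-out X (λ _ → c)
∑∋-const {X = outside ∷ X} (there p) c = ∑∋-const p c
∑∋-const {X = inside ∷ X}  (there p) c = +-cong (∑∋-const p c) (∑∋-const p c)

-- The part of an affine function orthogonal to constants.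
balanced : ∀ {u} (X : Subset u) → (Fin u → ℝ) → SetFn X
balanced X y S = sumE (set S) (λ i → y i + y i) - sumE X y

balanced-out : ∀ {u} (X : Subset u) y S →
  balanced (inside ∷ X) y (outₚ S) ≈ balanced X (y ∘ suc) S - y zero
balanced-out X y S = ≈-termwise λ n →
  solve 3 (λ a b z → a :- (z :+ b) := (a :- b) :- z) refl
    (seq (sumE (set S) (λ i → y (suc i) + y (suc i))) n)
    (seq (sumE X (y ∘ suc)) n) (seq (y zero) n)

balanced-in : ∀ {u} (X : Subset u) y S →
  balanced (inside ∷ X) y (inₚ S) ≈ balanced X (y ∘ suc) S + y zero
balanced-in X y S = ≈-termwise λ n →
  solve 3 (λ a b z → ((z :+ z) :+ a) :- (z :+ b) := (a :- b) :+ z) refl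
    (seq (sumE (set S) (λ i → y (suc i) + y (suc i))) n)
    (seq (sumE X (y ∘ suc)) n) (seq (y zero) n)

∑-balanced : ∀ {u} (X : Subset u) y → ∑ X (balanced X y) ≈ 0ℝ
∑-balanced []            y = ≈0⇐ ≈-refl
∑-balanced (outside ∷ X) y = ∑-balanced X (y ∘ suc)
∑-balanced (inside ∷ X)  y =
  ≈-trans (+-cong (∑-cong (balanced-out X y)) (∑-cong (balanced-in X y)))
  (≈-trans (+-cong (∑-sub X b (λ _ → y zero)) (∑-+ X b (λ _ → y zero)))
  (≈-by (+-cong (∑-balanced X (y ∘ suc)) (∑-balanced X (y ∘ suc))) λ n →
    solve 2 (λ a z → (a :+ a) :- (con 0ℚ :+ con 0ℚ)
                  := ((a :- z) :+ (a :+ z)) :- con 0ℚ) refl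
      (seq (∑ X b) n) (seq (∑ X (λ _ → y zero)) n)))
  where b = balanced X (y ∘ suc)

∑∋-balanced : ∀ {u} {X : Subset u} {i} → i ∈ X → ∀ y →
  ∑∋ X i (balanced X y) + ∑∋ X i (balanced X y) ≈ ∑ X (λ _ → y i)
∑∋-balanced {X = inside ∷ X} here y = +-cong p p
  where
  b = balanced X (y ∘ suc)
  p : ∑∋ (inside ∷ X) zero (balanced (inside ∷ X) y) ≈ ∑ X (λ _ → y zero)
  p = ≈-trans (∑∋-here-out X (balanced (inside ∷ X) y))
      (≈-trans (∑-cong (balanced-in X y))
      (≈-trans (∑-+ X b (λ _ → y zero))
      (≈-trans (+-cong (∑-balanced X (y ∘ suc)) ≈-refl)
      (≈-termwise λ n → ℚ.+-identityˡ _))))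
∑∋-balanced {X = outside ∷ X} (there p) y = ∑∋-balanced p (y ∘ suc)
∑∋-balanced {X = inside ∷ X} {suc i} (there p) y =
  ≈-trans (+-cong q q)
  (≈-by (+-cong (∑∋-balanced p (y ∘ suc)) (∑∋-balanced p (y ∘ suc))) λ n →
    solve 2 (λ a c → ((a :+ a) :+ (a :+ a)) :- (c :+ c)
                  := ((a :+ a) :+ (a :+ a)) :- (c :+ c)) refl
      (seq (∑∋ X i b) n) (seq (∑ X (λ _ → y (suc i))) n))
  where
  b = balanced X (y ∘ suc)
  z = y zero
  q : ∑∋ (inside ∷ X) (suc i) (balanced (inside ∷ X) y) ≈ ∑∋ X i b + ∑∋ X i b
  q = ≈-trans (+-cong (∑∋-cong i (balanced-out X y)) (∑∋-cong i (balanced-in X y)))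
      (≈-trans (+-cong (∑∋-sub X i b (λ _ → z)) (∑∋-+ X i b (λ _ → z)))
      (≈-termwise λ n →
        solve 2 (λ a z → (a :- z) :+ (a :+ z) := a :+ a) refl
          (seq (∑∋ X i b) n) (seq (∑∋ X i (λ _ → z)) n)))

balanced-modular : ∀ {u} (X : Subset u) y → Modular (balanced X y)
balanced-modular X y =
  modular-cong (λ S → ≈-termwise λ n → ℚ.+-comm (seq (- sumE X y) n) _)
    (affine-modular {X = X} (- sumE X y) (λ i → y i + y i))

-- 2 (2 Σ_{S∋i} d(S) − Σ_S d(S)) = 2^|X| (d(i) − d(∅)) for modular d.
modular-∑∋ : ∀ {u} {X : Subset u} {i} (i∈X : i ∈ X) {d : SetFn X} → Modular d →
  let t = ∑∋ X i d + ∑∋ X i d - ∑ X d in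
  t + t ≈ ∑ X (λ _ → d ⁅ i∈X ⁆ₚ - d ∅ₚ)
modular-∑∋ {X = inside ∷ X} here {d} mod = +-cong p p
  where
  o = ∑ X (d ∘ outₚ)
  i = ∑ X (d ∘ inₚ)
  t = ∑∋ (inside ∷ X) zero d
  p : t + t - (o + i) ≈ ∑ X (λ _ → d ⁅ here ⁆ₚ - d ∅ₚ)
  p = ≈-trans (sub-cong (+-cong (∑∋-here-out X d) (∑∋-here-out X d)) ≈-refl)
      (≈-trans (≈-termwise λ n →
        solve 2 (λ o i → (i :+ i) :- (o :+ i) := i :- o) refl (seq o n) (seq i n))
      (≈-trans (≈-sym (∑-sub X (d ∘ inₚ) (d ∘ outₚ)))
        (∑-cong (modular-step {d = d} mod))))
modular-∑∋ {X = outside ∷ X} (there p) {d} mod =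
  modular-∑∋ p (modular-out {d = d} mod)
modular-∑∋ {X = inside ∷ X} {suc i} (there p) {d} mod =
  ≈-trans
    (≈-termwise λ n →
      solve 4 (λ a b c e →
          (((a :+ b) :+ (a :+ b)) :- (c :+ e)) :+ (((a :+ b) :+ (a :+ b)) :- (c :+ e))
       := (((a :+ a) :- c) :+ ((a :+ a) :- c)) :+ (((b :+ b) :- e) :+ ((b :+ b) :- e)))
        refl
        (seq (∑∋ X i (d ∘ outₚ)) n) (seq (∑∋ X i (d ∘ inₚ)) n)
        (seq (∑ X (d ∘ outₚ)) n) (seq (∑ X (d ∘ inₚ)) n))
    (+-cong (modular-∑∋ p (modular-out {d = d} mod))
      (≈-trans (modular-∑∋ p modIn) (∑-cong {X = X} λ _ → diffs)))
  where
  modIn : Modular (d ∘ inₚ)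
  modIn A B = mod (inₚ A) (inₚ B)
  diffs : d (inₚ ⁅ p ⁆ₚ) - d (inₚ ∅ₚ) ≈ d (outₚ ⁅ p ⁆ₚ) - d ∅ₚ
  diffs = ≈-by (≈-trans (modular-step {d = d} mod ⁅ p ⁆ₚ)
                        (≈-sym (modular-step {d = d} mod ∅ₚ))) λ n →
    solve 4 (λ a b c e → (a :- b) :- (c :- e) := (a :- c) :- (b :- e)) refl
      (seq (d (inₚ ⁅ p ⁆ₚ)) n) (seq (d (outₚ ⁅ p ⁆ₚ)) n)
      (seq (d (inₚ ∅ₚ)) n) (seq (d ∅ₚ) n)

------------------------------------------------------------------------
-- Each 𝒮 is complementary to the modular functions.

HasStandardization : ∀ {u} {X : Subset u} → (SetFn X → Set) → Set
HasStandardization {X = X} 𝒮 =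
  (m : SetFn X) → ∃! _≐_ (IsStandardization 𝒮 m)

-- A linear 𝒮 meeting the modular functions only in 0 gives uniqueness.
standardization-unique : ∀ {u} {X : Subset u} {𝒮 : SetFn X → Set} →
  (∀ {s s′} → 𝒮 s → 𝒮 s′ → 𝒮 (s ⊖ s′)) →
  (∀ {d} → 𝒮 d → Modular d → ∀ S → d S ≈ 0ℝ) →
  ∀ {m s s′} → IsStandardization 𝒮 m s → IsStandardization 𝒮 m s′ → s ≐ s′
standardization-unique sub triv {m} {s} {s′} (p , pm) (q , qm) S =
  diff≈0 (triv (sub p q) mod S)
  where
  mod : Modular (s ⊖ s′)
  mod = modular-cong
    (λ A → ≈-termwise λ n →
      solve 3 (λ m s t → (m :- t) :- (m :- s) := s :- t) refl
        (seq (m A) n) (seq (s A) n) (seq (s′ A) n))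
    (modular-⊖ {m = m ⊖ s′} {m ⊖ s} qm pm)

m-[m-l] : ∀ {u} {X : Subset u} {m l : SetFn X} →
          Modular l → Modular (m ⊖ (m ⊖ l))
m-[m-l] {m = m} {l} = modular-cong λ A → ≈-termwise λ n →
  solve 2 (λ m l → l := m :- (m :- l)) refl (seq (m A) n) (seq (l A) n)

0-0 : ∀ {x y} → x ≈ 0ℝ → y ≈ 0ℝ → x - y ≈ 0ℝ
0-0 p q = ≈0⇐ (≈-trans p (≈-sym q))

modular-𝒮ℓ : ∀ {u} {X : Subset u} {d : SetFn X} →
             𝒮ℓ d → Modular d → ∀ S → d S ≈ 0ℝ
modular-𝒮ℓ {d = d} (d∅ , di) mod S =
  ≈-trans (modular-const {d = d} mod (λ p → ≈-trans (di p) (≈-sym d∅)) S) d∅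

⁅⁆∪remove : ∀ {u} {X : Subset u} {i} → i ∈ X → ⁅ i ⁆ ∪ (X ─ ⁅ i ⁆) ≡ X
⁅⁆∪remove {X = _ ∷ X} here =
  cong (inside ∷_) (trans (∪-identityˡ (X ─ ⊥)) (p─⊥≡p X))
⁅⁆∪remove {X = outside ∷ X} (there p) = cong (outside ∷_) (⁅⁆∪remove p)
⁅⁆∪remove {X = inside ∷ X}  (there p) = cong (inside ∷_) (⁅⁆∪remove p)

⁅⁆∩remove : ∀ {u} {X : Subset u} {i} → i ∈ X → ⁅ i ⁆ ∩ (X ─ ⁅ i ⁆) ≡ ⊥
⁅⁆∩remove {X = _ ∷ X} here = cong (outside ∷_) (∩-zeroˡ (X ─ ⊥))
⁅⁆∩remove {X = outside ∷ X} (there p) = cong (outside ∷_) (⁅⁆∩remove p)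
⁅⁆∩remove {X = inside ∷ X}  (there p) = cong (outside ∷_) (⁅⁆∩remove p)

modular-𝒮u : ∀ {u} {X : Subset u} {d : SetFn X} →
             𝒮u d → Modular d → ∀ S → d S ≈ 0ℝ
modular-𝒮u {X = X} {d} (dX , di) mod S =
  ≈-trans (const S) (≈-trans (≈-sym (const fullₚ)) dX)
  where
  single : ∀ {i} (p : i ∈ X) → d ⁅ p ⁆ₚ ≈ d ∅ₚ
  single {i} p = ≈-by
    (+-cong (≈-trans (mod ⁅ p ⁆ₚ (removeₚ i))
              (≈-reflexive (cong₂ (λ S T → d S + d T)
                (𝒫-≡ (⁅⁆∪remove p)) (𝒫-≡ (⁅⁆∩remove p)))))
            (0-0 dX (di p)))
    λ n → solve 4 (λ a r x e → ((a :+ r) :+ (x :- r)) :- ((x :+ e) :+ con 0ℚ)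
                            := a :- e) refl
      (seq (d ⁅ p ⁆ₚ) n) (seq (d (removeₚ i)) n) (seq (d fullₚ) n) (seq (d ∅ₚ) n)
  const : ∀ S → d S ≈ d ∅ₚ
  const = modular-const {d = d} mod single

modular-𝒮o : ∀ {u} {X : Subset u} {d : SetFn X} →
             𝒮o d → Modular d → ∀ S → d S ≈ 0ℝ
modular-𝒮o {X = X} {d} (∑d , ∑id) mod S = ≈-trans (const S)
  (∑-const-cancel X (≈-trans (∑-cong λ T → ≈-sym (const T)) ∑d))
  where
  0+0 : ∀ {x y} → x ≈ 0ℝ → y ≈ 0ℝ → x + y ≈ 0ℝ
  0+0 p q = ≈-trans (+-cong p q) (x+0 ≈-refl)
  single : ∀ {i} (p : i ∈ X) → d ⁅ p ⁆ₚ ≈ d ∅ₚ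
  single {i} p = diff≈0 (∑-const-cancel X
    (≈-trans (≈-sym (modular-∑∋ p {d} mod)) (0+0 t t)))
    where
    t : ∑∋ X i d + ∑∋ X i d - ∑ X d ≈ 0ℝ
    t = 0-0 (0+0 (∑id p) (∑id p)) ∑d
  const : ∀ S → d S ≈ d ∅ₚ
  const = modular-const {d = d} mod single

standardize-ℓ : ∀ {u} {X : Subset u} → HasStandardization (𝒮ℓ {X = X})
standardize-ℓ {u} {X} m =
  m ⊖ l , ((s∅ , si) , m-[m-l] {m = m} {l} (affine-modular {X = X} c x)) ,
  λ q → standardization-unique {𝒮 = 𝒮ℓ}
          (λ (a , b) (a′ , b′) → 0-0 a a′ , λ p → 0-0 (b p) (b′ p))
          modular-𝒮ℓ {m = m}
          ((s∅ , si) , m-[m-l] {m = m} {l} (affine-modular {X = X} c x)) q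
  where
  c = m ∅ₚ
  x : Fin u → ℝ
  x i = m (mk𝒫 (⁅ i ⁆ ∩ X) (λ {y} → p∩q⊆q ⁅ i ⁆ X {y})) - m ∅ₚ
  l : SetFn X
  l = affine c x
  s∅ : m ∅ₚ - l ∅ₚ ≈ 0ℝ
  s∅ = ≈0⇐ (≈-sym (x+0 (sumE-⊥ x)))
  ⁅⁆∩X : ∀ {u} {X : Subset u} {i} → i ∈ X → ⁅ i ⁆ ∩ X ≡ ⁅ i ⁆
  ⁅⁆∩X {X = _ ∷ X} here = cong (inside ∷_) (∩-zeroˡ X)
  ⁅⁆∩X (there p) = cong (outside ∷_) (⁅⁆∩X p)
  si : ∀ {i} (p : i ∈ X) → m ⁅ p ⁆ₚ - l ⁅ p ⁆ₚ ≈ 0ℝ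
  si {i} p = ≈0⇐ (≈-sym (≈-trans (+-cong ≈-refl (sumE-⁅⁆ i x))
    (≈-trans (≈-termwise λ n →
        solve 2 (λ a b → a :+ (b :- a) := b) refl (seq (m ∅ₚ) n) (seq (m _) n))
      (≈-reflexive (cong m (𝒫-≡ (⁅⁆∩X p)))))))

standardize-u : ∀ {u} {X : Subset u} → HasStandardization (𝒮u {X = X})
standardize-u {u} {X} m =
  m ⊖ l , ((sX , si) , m-[m-l] {m = m} {l} (affine-modular {X = X} c x)) ,
  λ q → standardization-unique {𝒮 = 𝒮u}
          (λ (a , b) (a′ , b′) → 0-0 a a′ , λ p → 0-0 (b p) (b′ p))
          modular-𝒮u {m = m}
          ((sX , si) , m-[m-l] {m = m} {l} (affine-modular {X = X} c x)) q
  where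
  x : Fin u → ℝ
  x i = m fullₚ - m (removeₚ i)
  c = m fullₚ - sumE X x
  l : SetFn X
  l = affine c x
  sX : m fullₚ - l fullₚ ≈ 0ℝ
  sX = ≈-termwise λ n →
    solve 2 (λ a b → a :- ((a :- b) :+ b) := con 0ℚ) refl
      (seq (m fullₚ) n) (seq (sumE X x) n)
  si : ∀ {i} → i ∈ X → m (removeₚ i) - l (removeₚ i) ≈ 0ℝ
  si {i} p = ≈-by (sumE-remove p x) λ n →
    solve 4 (λ r a b t → b :- (t :+ (a :- r))
                      := (r :- ((a :- b) :+ t)) :- con 0ℚ) refl
      (seq (m (removeₚ i)) n) (seq (m fullₚ) n) (seq (sumE X x) n)
      (seq (sumE (X ─ ⁅ i ⁆) x) n)

standardize-o : ∀ {u} {X : Subset u} → HasStandardization (𝒮o {X = X})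
standardize-o {u} {X} m =
  m ⊖ l , ((s∑ , si) , m-[m-l] {m = m} {l} l-modular) ,
  λ q → standardization-unique {𝒮 = 𝒮o} 𝒮o-⊖ modular-𝒮o {m = m}
          ((s∑ , si) , m-[m-l] {m = m} {l} l-modular) q
  where
  𝒮o-⊖ : ∀ {s s′ : SetFn X} → 𝒮o s → 𝒮o s′ → 𝒮o (s ⊖ s′)
  𝒮o-⊖ {s} {s′} (a , b) (a′ , b′) =
    ≈-trans (∑-sub X s s′) (0-0 a a′) ,
    λ {i} p → ≈-trans (∑∋-sub X i s s′) (0-0 (b p) (b′ p))
  t : Fin u → ℝ
  t i = ∑∋ X i m + ∑∋ X i m - ∑ X m
  y : Fin u → ℝ
  y i = mean X (t i)
  c = mean X (∑ X m)
  b l : SetFn X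
  b = balanced X y
  l S = c + b S
  l-modular : Modular l
  l-modular A B = ≈-by (balanced-modular X y A B) λ n →
    solve 5 (λ c p q r s → (p :+ q) :- (r :+ s)
                        := ((c :+ p) :+ (c :+ q)) :- ((c :+ r) :+ (c :+ s))) refl
      (seq c n) (seq (b A) n) (seq (b B) n) (seq (b (A ∪ₚ B)) n) (seq (b (A ∩ₚ B)) n)
  s∑ : ∑ X (m ⊖ l) ≈ 0ℝ
  s∑ = ≈-trans (∑-sub X m l) (≈0⇐ (≈-sym
    (≈-trans (∑-+ X (λ _ → c) b)
    (≈-trans (+-cong (∑-mean X (∑ X m)) (∑-balanced X y)) (x+0 ≈-refl)))))
  si : ∀ {i} → i ∈ X → ∑∋ X i (m ⊖ l) ≈ 0ℝ
  si {i} p = ≈-trans (∑∋-sub X i m l) (≈0⇐ (double-cancel (≈-sym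
    (≈-trans (+-cong (∑∋-+ X i (λ _ → c) b) (∑∋-+ X i (λ _ → c) b))
    (≈-by (+-cong (≈-trans (∑∋-const p c) (∑-mean X (∑ X m)))
                  (≈-trans (∑∋-balanced p y) (∑-mean X (t i)))) λ n →
      solve 4 (λ k w s a →
          ((k :+ k) :+ (w :+ w)) :- (s :+ ((a :+ a) :- s))
       := ((k :+ w) :+ (k :+ w)) :- (a :+ a)) refl
        (seq (∑∋ X i (λ _ → c)) n) (seq (∑∋ X i b) n)
        (seq (∑ X m) n) (seq (∑∋ X i m) n))))))

infix 9 _ℓ _ᵤ _ₒ
_ℓ _ᵤ _ₒ : ∀ {u} {X : Subset u} → SetFn X → SetFn X
m ℓ = proj₁ (standardize-ℓ m)
m ᵤ = proj₁ (standardize-u m)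
m ₒ = proj₁ (standardize-o m)

{-# OPTIONS --safe #-}

-- Restriction S ↦ S ∩ M is a surjective lattice homomorphism 𝒫 N → 𝒫 M, so
-- lifting preserves and reflects supermodularity and preserves modularity.
-- As standardizations are unique, (ii) amounts to 𝒮 being stable under lifting.

module Submission where

open import Defs
open import Data.Fin.Subset using (Subset; _∈_; _∉_; _⊆_; ∣_∣)
open import Data.Nat.Base as ℕ using (ℕ)
open import Data.Product using (_×_; _,_; proj₁; ∃; Σ-syntax)
open import Data.Sum.Base using (_⊎_)
open import Function.Bundles using (_⇔_)

open import Data.Bool.Base using (if_then_else_)
open import Data.Empty using (⊥-elim)
open import Data.Fin.Base using (zero; suc)
open import Data.Fin.Subset
  using (inside; outside; ⊥; ⁅_⁆; _∩_; _─_)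
open import Data.Fin.Subset.Properties
import Data.Rational.Base as ℚ
open import Data.Rational.Solver using (module +-*-Solver)
open import Data.Sum.Base using (inj₁; inj₂)
open import Data.Vec.Base using ([]; _∷_; here; there)
open import Function.Base using (_∘_)
open import Function.Bundles using (mk⇔)
open import Relation.Binary.PropositionalEquality
  using (_≡_; refl; sym; trans; cong; cong₂; subst; subst₂)
open import Relation.Nullary using (does; yes; no)
open import Relation.Nullary.Decidable using (does-⇔; recompute)

open +-*-Solver using (solve; _:+_; _:-_; _:=_; con)

-- Identities for intersection and difference of subsets

p⊆q⇒p∩q≡p : ∀ {u} {p q : Subset u} → p ⊆ q → p ∩ q ≡ p
p⊆q⇒p∩q≡p {p = p} {q} p⊆q =
  ⊆-antisym (p∩q⊆p p q) (λ x∈p → x∈p∩q⁺ (x∈p , p⊆q x∈p))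

p⊆q⇒q∩p≡p : ∀ {u} {p q : Subset u} → p ⊆ q → q ∩ p ≡ p
p⊆q⇒q∩p≡p {p = p} {q} p⊆q = trans (∩-comm q p) (p⊆q⇒p∩q≡p p⊆q)

x∉p⇒⁅x⁆∩p≡⊥ : ∀ {u} {x} {p : Subset u} → x ∉ p → ⁅ x ⁆ ∩ p ≡ ⊥
x∉p⇒⁅x⁆∩p≡⊥ {x = x} {p} x∉p = ⊆-antisym
  (λ y∈ → let y∈x , y∈p = x∈p∩q⁻ ⁅ x ⁆ p y∈ in
    ⊥-elim (x∉p (subst (_∈ p) (x∈⁅y⁆⇒x≡y x y∈x) y∈p)))
  (⊆-min (⁅ x ⁆ ∩ p))

x∈p⇒⁅x⁆∩p≡⁅x⁆ : ∀ {u} {x} {p : Subset u} → x ∈ p → ⁅ x ⁆ ∩ p ≡ ⁅ x ⁆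
x∈p⇒⁅x⁆∩p≡⁅x⁆ {x = x} {p} x∈p =
  p⊆q⇒p∩q≡p (λ y∈ → subst (_∈ p) (sym (x∈⁅y⁆⇒x≡y x y∈)) x∈p)

x∉p⇒p─⁅x⁆≡p : ∀ {u} {x} {p : Subset u} → x ∉ p → p ─ ⁅ x ⁆ ≡ p
x∉p⇒p─⁅x⁆≡p {x = x} {p} x∉p = ⊆-antisym (p─q⊆p p ⁅ x ⁆)
  (λ y∈p → x∈p∧x≢y⇒x∈p-y y∈p (λ { refl → x∉p y∈p }))

∩-─-comm : ∀ {u} (p q r : Subset u) → (p ─ q) ∩ r ≡ (p ∩ r) ─ q
∩-─-comm [] [] [] = refl
∩-─-comm (s ∷ p) (outside ∷ q) (t ∷ r) = cong (_ ∷_) (∩-─-comm p q r)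
∩-─-comm (s ∷ p) (inside ∷ q)  (t ∷ r) = cong (outside ∷_) (∩-─-comm p q r)

-- Restriction as a lattice homomorphism, and its section

module _ {u} {N M : Subset u} where

  restrict-∪ : (A B : 𝒫 N) →
               restrict M (A ∪ₚ B) ≡ restrict M A ∪ₚ restrict M B
  restrict-∪ A B = 𝒫-≡ (∩-distribʳ-∪ M (set A) (set B))

  restrict-∩ : (A B : 𝒫 N) →
               restrict M (A ∩ₚ B) ≡ restrict M A ∩ₚ restrict M B
  restrict-∩ A B = 𝒫-≡ (⊆-antisym
    (λ x∈ → let x∈AB , x∈M = x∈p∩q⁻ (set A ∩ set B) M x∈
                x∈A , x∈B = x∈p∩q⁻ (set A) (set B) x∈AB
            in x∈p∩q⁺ (x∈p∩q⁺ (x∈A , x∈M) , x∈p∩q⁺ (x∈B , x∈M)))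
    (λ x∈ → let x∈AM , x∈BM = x∈p∩q⁻ (set A ∩ M) (set B ∩ M) x∈
                x∈A , x∈M = x∈p∩q⁻ (set A) M x∈AM
                x∈B , _ = x∈p∩q⁻ (set B) M x∈BM
            in x∈p∩q⁺ (x∈p∩q⁺ (x∈A , x∈B) , x∈M)))

  restrict-∅ : restrict {N = N} M ∅ₚ ≡ ∅ₚ
  restrict-∅ = 𝒫-≡ (∩-zeroˡ M)

  restrict-⁅⁆-∈ : ∀ {i} (i∈N : i ∈ N) (i∈M : i ∈ M) →
                  restrict M ⁅ i∈N ⁆ₚ ≡ ⁅ i∈M ⁆ₚ
  restrict-⁅⁆-∈ _ i∈M = 𝒫-≡ (x∈p⇒⁅x⁆∩p≡⁅x⁆ i∈M)

  restrict-⁅⁆-∉ : ∀ {i} (i∈N : i ∈ N) → i ∉ M → restrict M ⁅ i∈N ⁆ₚ ≡ ∅ₚ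
  restrict-⁅⁆-∉ _ i∉M = 𝒫-≡ (x∉p⇒⁅x⁆∩p≡⊥ i∉M)

  module _ (M⊆N : M ⊆ N) where

    restrict-full : restrict {N = N} M fullₚ ≡ fullₚ
    restrict-full = 𝒫-≡ (p⊆q⇒q∩p≡p M⊆N)

    -- Uniform in `i`: for `i ∉ M` the right side is all of `M` by `remove-∉`, which is how
    -- conditions at N∖i turn into the condition at `M`.
    restrict-remove : ∀ i → restrict {N = N} M (removeₚ i) ≡ removeₚ i
    restrict-remove i = 𝒫-≡ (trans (∩-─-comm N ⁅ i ⁆ M)
                                   (cong (_─ ⁅ i ⁆) (p⊆q⇒q∩p≡p M⊆N)))

    -- A section of `restrict M`; it witnesses the surjectivity by which supermodularity is
    -- reflected.
    extend : 𝒫 M → 𝒫 N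
    extend (mk𝒫 A A⊆M) = mk𝒫 A (λ x∈A → M⊆N (A⊆M x∈A))

    restrict-extend : ∀ A → restrict M (extend A) ≡ A
    restrict-extend (mk𝒫 A A⊆M) = 𝒫-≡ (lemma A⊆M)
      where
      lemma : .(A ⊆ M) → A ∩ M ≡ A
      lemma A⊆M = ⊆-antisym (p∩q⊆p A M)
        -- The inclusion is irrelevant, so the membership it yields is recovered from the decision
        -- procedure.
        (λ {x} x∈A → x∈p∩q⁺ (x∈A , recompute (x ∈? M) (A⊆M x∈A)))

remove-∉ : ∀ {u} {X : Subset u} {i} → i ∉ X → removeₚ {X = X} i ≡ fullₚ
remove-∉ i∉X = 𝒫-≡ (x∉p⇒p─⁅x⁆≡p i∉X)

-- Second differences

module _ {u} {X : Subset u} where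

  ∅-∪ : (A : 𝒫 X) → ∅ₚ ∪ₚ A ≡ A
  ∅-∪ A = 𝒫-≡ (∪-identityˡ (set A))

  -- The expression in `_⊥_∣_[_]` with arbitrary sets for the two singletons, because a singleton
  -- restricted to `M` may become empty.
  secondDifference : SetFn X → 𝒫 X → 𝒫 X → 𝒫 X → ℝ
  secondDifference m A B C =
    m (A ∪ₚ B ∪ₚ C) + m C - m (A ∪ₚ C) - m (B ∪ₚ C)

  secondDifference-∅ˡ : ∀ m B C → secondDifference m ∅ₚ B C ≈ 0ℝ
  secondDifference-∅ˡ m B C =
    subst₂ (λ S T → m S + m C - m T - m (B ∪ₚ C) ≈ 0ℝ)
      (sym (∅-∪ (B ∪ₚ C))) (sym (∅-∪ C))
      (≈-termwise λ n →
        solve 2 (λ b c → ((b :+ c) :- c) :- b := con ℚ.0ℚ) refl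
          (seq (m (B ∪ₚ C)) n) (seq (m C) n))

  secondDifference-∅ʳ : ∀ m A C → secondDifference m A ∅ₚ C ≈ 0ℝ
  secondDifference-∅ʳ m A C =
    subst (λ S → m (A ∪ₚ S) + m C - m (A ∪ₚ C) - m S ≈ 0ℝ) (sym (∅-∪ C))
      (≈-termwise λ n →
        solve 2 (λ a c → ((a :+ c) :- a) :- c := con ℚ.0ℚ) refl
          (seq (m (A ∪ₚ C)) n) (seq (m C) n))

-- Supermodularity, modularity and independence under lifting

module _ {u} {N M : Subset u} where

  lift-secondDifference : ∀ (r : SetFn M) A B C →
    secondDifference (lift N r) A B C ≡
    secondDifference r (restrict M A) (restrict M B) (restrict M C)
  lift-secondDifference r A B C =
    cong₂ _-_
      (cong₂ (λ S T → r S + r (restrict M C) - r T)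
        (trans (restrict-∪ A (B ∪ₚ C))
               (cong (restrict M A ∪ₚ_) (restrict-∪ B C)))
        (restrict-∪ A C))
      (cong r (restrict-∪ B C))

  lift-supermodular : (r : SetFn M) → Supermodular r → Supermodular (lift N r)
  lift-supermodular r sup A B =
    subst₂ (λ S T → lift N r A + lift N r B ≤ r S + r T)
      (sym (restrict-∪ A B)) (sym (restrict-∩ A B))
      (sup (restrict M A) (restrict M B))

  lift-modular : (r : SetFn M) → Modular r → Modular (lift N r)
  lift-modular r mod A B =
    subst₂ (λ S T → lift N r A + lift N r B ≈ r S + r T)
      (sym (restrict-∪ A B)) (sym (restrict-∩ A B))
      (mod (restrict M A) (restrict M B))

  -- Restriction keeps a singleton inside `M` and empties any other. An empty argument makes the
  -- second difference vanish; otherwise it is the one of `r` at the same two elements.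
  lift-independence : (r : SetFn M) (a b : ∃ (_∈ N)) (C : 𝒫 N) →
    (a ⊥ b ∣ C [ lift N r ])
      ⇔ ( proj₁ a ∉ M
        ⊎ proj₁ b ∉ M
        ⊎ (Σ[ a∈M ∈ proj₁ a ∈ M ] Σ[ b∈M ∈ proj₁ b ∈ M ]
            ((proj₁ a , a∈M) ⊥ (proj₁ b , b∈M) ∣ restrict M C [ r ])))
  lift-independence r (a , a∈N) (b , b∈N) C = mk⇔ to from
    where
    D : ℝ
    D = secondDifference (lift N r) ⁅ a∈N ⁆ₚ ⁅ b∈N ⁆ₚ C

    -- Taking the restricted singletons up to equations covers all cases at once; `refl` leaves one
    -- of them unevaluated.
    D≡ : ∀ {A B} → restrict M ⁅ a∈N ⁆ₚ ≡ A → restrict M ⁅ b∈N ⁆ₚ ≡ B →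
         D ≡ secondDifference r A B (restrict M C)
    D≡ refl refl = lift-secondDifference r ⁅ a∈N ⁆ₚ ⁅ b∈N ⁆ₚ C

    both : (a∈M : a ∈ M) (b∈M : b ∈ M) →
           D ≡ secondDifference r ⁅ a∈M ⁆ₚ ⁅ b∈M ⁆ₚ (restrict M C)
    both a∈M b∈M = D≡ (restrict-⁅⁆-∈ a∈N a∈M) (restrict-⁅⁆-∈ b∈N b∈M)

    to : D ≈ 0ℝ → _
    to D≈0 with a ∈? M | b ∈? M
    ... | no a∉M  | _       = inj₁ a∉M
    ... | yes _   | no b∉M  = inj₂ (inj₁ b∉M)
    ... | yes a∈M | yes b∈M =
      inj₂ (inj₂ (a∈M , b∈M , subst (_≈ 0ℝ) (both a∈M b∈M) D≈0))

    from : _ → D ≈ 0ℝ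
    from (inj₁ a∉M) = subst (_≈ 0ℝ) (sym (D≡ (restrict-⁅⁆-∉ a∈N a∉M) refl))
      (secondDifference-∅ˡ r (restrict M ⁅ b∈N ⁆ₚ) (restrict M C))
    from (inj₂ (inj₁ b∉M)) = subst (_≈ 0ℝ) (sym (D≡ refl (restrict-⁅⁆-∉ b∈N b∉M)))
      (secondDifference-∅ʳ r (restrict M ⁅ a∈N ⁆ₚ) (restrict M C))
    from (inj₂ (inj₂ (a∈M , b∈M , indep))) =
      subst (_≈ 0ℝ) (sym (both a∈M b∈M)) indep

  module _ (M⊆N : M ⊆ N) where

    lift-supermodular⁻ : (r : SetFn M) →
                         Supermodular (lift N r) → Supermodular r
    lift-supermodular⁻ r sup A B =
      -- `extend` commutes with `∪ₚ` and `∩ₚ` definitionally, inclusion proofs being irrelevant.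
      subst₂ _≤_ (cong₂ _+_ (eq A) (eq B)) (cong₂ _+_ (eq (A ∪ₚ B)) (eq (A ∩ₚ B)))
        (sup (extend M⊆N A) (extend M⊆N B))
      where
      eq : ∀ S → lift N r (extend M⊆N S) ≡ r S
      eq S = cong r (restrict-extend M⊆N S)

    -- Stability of `𝒮ℓ` and `𝒮u` under lifting

    lift-𝒮ℓ : (s : SetFn M) → 𝒮ℓ s → 𝒮ℓ (lift N s)
    lift-𝒮ℓ s (s∅ , si) = s∅′ , single
      where
      s∅′ : s (restrict {N = N} M ∅ₚ) ≈ 0ℝ
      s∅′ = subst (λ S → s S ≈ 0ℝ) (sym (restrict-∅ {N = N})) s∅
      single : ∀ {i} (i∈N : i ∈ N) → s (restrict M ⁅ i∈N ⁆ₚ) ≈ 0ℝ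
      single {i} i∈N with i ∈? M
      ... | yes i∈M = subst (λ S → s S ≈ 0ℝ) (sym (restrict-⁅⁆-∈ i∈N i∈M)) (si i∈M)
      ... | no i∉M  = subst (λ S → s S ≈ 0ℝ) (sym (restrict-⁅⁆-∉ i∈N i∉M)) s∅

    lift-𝒮u : (s : SetFn M) → 𝒮u s → 𝒮u (lift N s)
    lift-𝒮u s (sM , si) =
      subst (λ S → s S ≈ 0ℝ) (sym (restrict-full M⊆N)) sM ,
      λ {i} _ → subst (λ S → s S ≈ 0ℝ) (sym (restrict-remove M⊆N i)) (remove i)
      where
      remove : ∀ i → s (removeₚ i) ≈ 0ℝ
      remove i with i ∈? M
      ... | yes i∈M = si i∈M
      ... | no i∉M  = subst (λ S → s S ≈ 0ℝ) (sym (remove-∉ i∉M)) sM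

-- Sums of lifted functions and stability of `𝒮o`

0+0 : ∀ {x y} → x ≈ 0ℝ → y ≈ 0ℝ → x + y ≈ 0ℝ
0+0 p q = ≈-trans (+-cong p q) (x+0 ≈-refl)

-- The sum over N is 2^|N ─ M| times the sum over M.
∑-lift≈0 : ∀ {u} (N M : Subset u) → M ⊆ N → (s : SetFn M) →
           ∑ M s ≈ 0ℝ → ∑ N (lift N s) ≈ 0ℝ
∑-lift≈0 []            []            M⊆N s p = p
∑-lift≈0 (outside ∷ N) (outside ∷ M) M⊆N s p =
  ∑-lift≈0 N M (drop-∷-⊆ M⊆N) (s ∘ outₚ) p
∑-lift≈0 (outside ∷ N) (inside ∷ M)  M⊆N s p with () ← M⊆N here
∑-lift≈0 (inside ∷ N)  (outside ∷ M) M⊆N s p = 0+0 ih ih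
  where ih = ∑-lift≈0 N M (drop-∷-⊆ M⊆N) (s ∘ outₚ) p
∑-lift≈0 (inside ∷ N)  (inside ∷ M)  M⊆N s p =
  -- Only the total of the two halves is known to vanish, so they are merged into one function
  -- before the induction hypothesis applies.
  ≈-trans (≈-sym (∑-+ N (lift N (s ∘ outₚ)) (lift N (s ∘ inₚ))))
    (∑-lift≈0 N M (drop-∷-⊆ M⊆N) (λ S → s (outₚ S) + s (inₚ S))
      (≈-trans (∑-+ M (s ∘ outₚ) (s ∘ inₚ)) p))

-- Among the sets containing `i`, each subset of `M` arises as a restriction equally often, so the
-- sum is again a multiple of the full sum over `M`.
∑∋-lift-∉≈0 : ∀ {u} (N M : Subset u) → M ⊆ N → ∀ {i} → i ∈ N → i ∉ M →
              (s : SetFn M) → ∑ M s ≈ 0ℝ → ∑∋ N i (lift N s) ≈ 0ℝ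
∑∋-lift-∉≈0 (inside ∷ N)  (inside ∷ M)  M⊆N here i∉M s p = ⊥-elim (i∉M here)
∑∋-lift-∉≈0 (inside ∷ N)  (outside ∷ M) M⊆N here i∉M s p =
  ≈-trans (∑∋-here-out N (lift (inside ∷ N) s))
    (∑-lift≈0 N M (drop-∷-⊆ M⊆N) (s ∘ outₚ) p)
∑∋-lift-∉≈0 (outside ∷ N) (inside ∷ M)  M⊆N (there i∈N) i∉M s p with () ← M⊆N here
∑∋-lift-∉≈0 (outside ∷ N) (outside ∷ M) M⊆N (there i∈N) i∉M s p =
  ∑∋-lift-∉≈0 N M (drop-∷-⊆ M⊆N) i∈N (i∉M ∘ there) (s ∘ outₚ) p
∑∋-lift-∉≈0 (inside ∷ N)  (outside ∷ M) M⊆N (there i∈N) i∉M s p = 0+0 ih ih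
  where ih = ∑∋-lift-∉≈0 N M (drop-∷-⊆ M⊆N) i∈N (i∉M ∘ there) (s ∘ outₚ) p
∑∋-lift-∉≈0 (inside ∷ N)  (inside ∷ M)  M⊆N {suc i} (there i∈N) i∉M s p =
  ≈-trans (≈-sym (∑∋-+ N i (lift N (s ∘ outₚ)) (lift N (s ∘ inₚ))))
    (∑∋-lift-∉≈0 N M (drop-∷-⊆ M⊆N) i∈N (i∉M ∘ there)
      (λ S → s (outₚ S) + s (inₚ S))
      (≈-trans (∑-+ M (s ∘ outₚ) (s ∘ inₚ)) p))

-- For `i ∈ M`, membership of `i` in S depends only on S ∩ M. The masked lift is thus the lift of
-- the masked function, and `∑-lift≈0` applies.
∑∋-lift-∈≈0 : ∀ {u} (N M : Subset u) → M ⊆ N → ∀ {i} → i ∈ M →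
              (s : SetFn M) → ∑∋ M i s ≈ 0ℝ → ∑∋ N i (lift N s) ≈ 0ℝ
∑∋-lift-∈≈0 N M M⊆N {i} i∈M s p =
  ≈-trans (∑-cong {X = N} λ S → ≈-reflexive
    (cong (λ b → if b then lift N s S else 0ℝ)
      (does-⇔ (mk⇔ (λ i∈S → x∈p∩q⁺ (i∈S , i∈M)) (proj₁ ∘ x∈p∩q⁻ (set S) M))
        (i ∈? set S) (i ∈? set S ∩ M))))
    (∑-lift≈0 N M M⊆N (λ S → if does (i ∈? set S) then s S else 0ℝ) p)

lift-𝒮o : ∀ {u} {N M : Subset u} → M ⊆ N → (s : SetFn M) →
          𝒮o s → 𝒮o (lift N s)
lift-𝒮o {N = N} {M} M⊆N s (∑s , ∑is) = ∑-lift≈0 N M M⊆N s ∑s , single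
  where
  single : ∀ {i} → i ∈ N → ∑∋ N i (lift N s) ≈ 0ℝ
  single {i} i∈N with i ∈? M
  ... | yes i∈M = ∑∋-lift-∈≈0 N M M⊆N i∈M s (∑is i∈M)
  ... | no i∉M  = ∑∋-lift-∉≈0 N M M⊆N i∈N i∉M s ∑s

-- Lifting commutes with standardization

lift-standardization : ∀ {u} {N M : Subset u}
  {𝒮N : SetFn N → Set} {𝒮M : SetFn M → Set} →
  (∀ s → 𝒮M s → 𝒮N (lift N s)) →
  (stdN : HasStandardization 𝒮N) (stdM : HasStandardization 𝒮M) →
  ∀ r → proj₁ (stdN (lift N r)) ≐ lift N (proj₁ (stdM r))
lift-standardization lift-𝒮 stdN stdM r =
  let _ , _ , unique = stdN (lift _ r)
      s , (s∈𝒮 , mod) , _ = stdM r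
  -- `lift N r ⊖ lift N s` is definitionally `lift N (r ⊖ s)`, so its modularity comes from that of
  -- `r ⊖ s`.
  in unique (lift-𝒮 s s∈𝒮 , lift-modular (r ⊖ s) mod)

mainTheorem3 : ∀ {u : ℕ} (N M : Subset u) → 2 ℕ.≤ ∣ N ∣ → M ⊆ N → (r : SetFn M) →
    ( (Supermodular r ⇔ Supermodular (lift N r))
    × ((a b : ∃ (_∈ N)) (C : 𝒫 N) → IsTriplet a b C →
    (a ⊥ b ∣ C [ lift N r ])
    ⇔ ( proj₁ a ∉ M
    ⊎ proj₁ b ∉ M
    ⊎ (Σ[ a∈M ∈ proj₁ a ∈ M ] Σ[ b∈M ∈ proj₁ b ∈ M ]
    ((proj₁ a , a∈M) ⊥ (proj₁ b , b∈M) ∣ restrict M C [ r ]))))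
    × ((r′ : SetFn M) → Supermodular r′ → Supermodular (lift N r′)) )
    × ( Supermodular r →
    (lift N r) ℓ ≐ lift N (r ℓ)
    × (lift N r) ᵤ ≐ lift N (r ᵤ)
    × (lift N r) ₒ ≐ lift N (r ₒ) )
mainTheorem3 N M _ M⊆N r =
  ( mk⇔ (lift-supermodular r) (lift-supermodular⁻ M⊆N r)
  , (λ a b C _ → lift-independence r a b C)
  , lift-supermodular )
  , λ _ → lift-standardization {𝒮M = 𝒮ℓ} (lift-𝒮ℓ M⊆N) standardize-ℓ standardize-ℓ r
        , lift-standardization {𝒮M = 𝒮u} (lift-𝒮u M⊆N) standardize-u standardize-u r
        , lift-standardization {𝒮M = 𝒮o} (lift-𝒮o M⊆N) standardize-o standardize-o r
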